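{- There is an absolute constant $c>0$ such that the following holds. Let $A$ and $B$ be finite nonempty sets of real numbers, and suppose $A$ has distinct consecutive differences. Then \[ |A+B| \ge c\,|A|\,|B|^{1/2}. \] In particular, if $|A|=|B|$ then $|A+B|\ge c|A|^{3/2}$.
   Context: For finite $A,B\subset\mathbb{R}$, $A+B=\{a+b: a\in A, b\in B\}$. Writing $A=\{a_1<a_2<\dots<a_k\}$, the set $A$ has distinct consecutive differences if for $1\le i,j\le k-1$, $a_{i+1}-a_i=a_{j+1}-a_j$ implies $i=j$. -}

module Defs where

open import Data.Fin as Fin using (Fin; toℕ)
open import Data.Integer as ℤ using (+_)
import Data.Integer.Properties as ℤ
open import Data.Nat as ℕ using (ℕ; zero; suc)
import Data.Nat.Properties as ℕ
open import Data.Product using (_×_; _,_; ∃; ∃₂)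
open import Data.Rational as ℚ using (ℚ; 0ℚ; 1ℚ; ½; mkℚ; ∣_∣)
import Data.Rational.Properties as ℚ
open import Data.Rational.Solver using () renaming (module +-*-Solver to ℚ-Solver)
import Data.Rational.Unnormalised as ℚᵘ
import Data.Rational.Unnormalised.Properties as ℚᵘ
open import Data.Sum using (inj₁; inj₂)
open import Function using (_⇔_; Injective)
open import Level using (0ℓ)
open import Relation.Binary.PropositionalEquality
  using (_≡_; refl; sym; trans; cong; cong₂; subst; subst₂)
open import Relation.Nullary using (¬_; yes; no; contradiction)
open import Relation.Unary using (Pred)

-- Equality of reals is _≈_, not _≡_.
record ℝ : Set where
  constructor mkℝ
  field
    seq    : ℕ → ℚ
    cauchy : ∀ ε → 0ℚ ℚ.< ε → ∃ λ N → ∀ m n → N ℕ.≤ m → N ℕ.≤ n →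
             ∣ seq m ℚ.- seq n ∣ ℚ.< ε

open ℝ public

infix 4 _≈_ _<_ _≤_

_≈_ : ℝ → ℝ → Set
x ≈ y = ∀ ε → 0ℚ ℚ.< ε → ∃ λ N → ∀ n → N ℕ.≤ n → ∣ seq x n ℚ.- seq y n ∣ ℚ.< ε

-- The gap ε must be uniform: an eventual termwise inequality alone would
-- also hold between distinct representatives of the same real.
_<_ : ℝ → ℝ → Set
x < y = ∃ λ ε → 0ℚ ℚ.< ε × ∃ λ N → ∀ n → N ℕ.≤ n → seq x n ℚ.+ ε ℚ.< seq y n

_≤_ : ℝ → ℝ → Set
x ≤ y = ¬ (y < x)

half+half : ∀ ε → ½ ℚ.* ε ℚ.+ ½ ℚ.* ε ≡ ε
half+half = solve 1 (λ e → con ½ :* e :+ con ½ :* e := e) refl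
  where open ℚ-Solver

*-pos : ∀ {p q} → 0ℚ ℚ.< p → 0ℚ ℚ.< q → 0ℚ ℚ.< p ℚ.* q
*-pos {p} {q} 0<p 0<q = subst (ℚ._< p ℚ.* q) (ℚ.*-zeroʳ p)
  (ℚ.*-monoʳ-<-pos p {{ℚ.positive 0<p}} 0<q)

half-pos : ∀ {ε} → 0ℚ ℚ.< ε → 0ℚ ℚ.< ½ ℚ.* ε
half-pos = *-pos (ℚ.positive⁻¹ ½)

*-mono-≤-nonNeg : ∀ {p q r s} → 0ℚ ℚ.≤ p → 0ℚ ℚ.≤ s → p ℚ.≤ q → r ℚ.≤ s →
                  p ℚ.* r ℚ.≤ q ℚ.* s
*-mono-≤-nonNeg {p} {q} {r} {s} 0≤p 0≤s p≤q r≤s = ℚ.≤-trans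
  (ℚ.*-monoˡ-≤-nonNeg p {{ℚ.nonNegative 0≤p}} r≤s)
  (ℚ.*-monoʳ-≤-nonNeg s {{ℚ.nonNegative 0≤s}} p≤q)

infix  8 -_
infixl 7 _*_
infixl 6 _+_ _-_

fromℚ : ℚ → ℝ
fromℚ q = mkℝ (λ _ → q) λ ε 0<ε → 0 , λ _ _ _ _ →
  subst (λ d → ∣ d ∣ ℚ.< ε) (sym (ℚ.+-inverseʳ q)) 0<ε

fromℕ : ℕ → ℝ
fromℕ n = fromℚ (+ n ℚ./ 1)

0ℝ : ℝ
0ℝ = fromℕ 0

_+_ : ℝ → ℝ → ℝ
x + y = mkℝ (λ n → seq x n ℚ.+ seq y n) λ ε 0<ε →
  let M , p = cauchy x (½ ℚ.* ε) (half-pos 0<ε)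
      N , q = cauchy y (½ ℚ.* ε) (half-pos 0<ε)
  in M ℕ.⊔ N , λ m n m≥ n≥ → begin-strict
    ∣ (seq x m ℚ.+ seq y m) ℚ.- (seq x n ℚ.+ seq y n) ∣
      ≡⟨ cong ∣_∣ (regroup (seq x m) (seq y m) (seq x n) (seq y n)) ⟩
    ∣ (seq x m ℚ.- seq x n) ℚ.+ (seq y m ℚ.- seq y n) ∣
      ≤⟨ ℚ.∣p+q∣≤∣p∣+∣q∣ (seq x m ℚ.- seq x n) (seq y m ℚ.- seq y n) ⟩
    ∣ seq x m ℚ.- seq x n ∣ ℚ.+ ∣ seq y m ℚ.- seq y n ∣
      <⟨ ℚ.+-mono-< (p m n (ℕ.m⊔n≤o⇒m≤o M N m≥) (ℕ.m⊔n≤o⇒m≤o M N n≥))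
                    (q m n (ℕ.m⊔n≤o⇒n≤o M N m≥) (ℕ.m⊔n≤o⇒n≤o M N n≥)) ⟩
    ½ ℚ.* ε ℚ.+ ½ ℚ.* ε
      ≡⟨ half+half ε ⟩
    ε ∎
  where
  open ℚ.≤-Reasoning
  regroup : ∀ a b c d → (a ℚ.+ b) ℚ.- (c ℚ.+ d) ≡ (a ℚ.- c) ℚ.+ (b ℚ.- d)
  regroup = solve 4 (λ a b c d → (a :+ b) :- (c :+ d) := (a :- c) :+ (b :- d)) refl
    where open ℚ-Solver

-_ : ℝ → ℝ
- x = mkℝ (λ n → ℚ.- seq x n) λ ε 0<ε →
  let N , p = cauchy x ε 0<ε
  in N , λ m n m≥ n≥ → subst (ℚ._< ε)
    (trans (sym (ℚ.∣-p∣≡∣p∣ (seq x m ℚ.- seq x n)))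
           (cong ∣_∣ (ℚ.neg-distrib-+ (seq x m) (ℚ.- seq x n))))
    (p m n m≥ n≥)

_-_ : ℝ → ℝ → ℝ
x - y = x + (- y)

eventually-bounded : ∀ x → ∃ λ K → 0ℚ ℚ.< K × ∃ λ N → ∀ n → N ℕ.≤ n →
                     ∣ seq x n ∣ ℚ.≤ K
eventually-bounded x =
  let N , p = cauchy x 1ℚ (ℚ.positive⁻¹ 1ℚ)
      a     = seq x N
  in 1ℚ ℚ.+ ∣ a ∣
   , ℚ.+-mono-<-≤ (ℚ.positive⁻¹ 1ℚ) (ℚ.0≤∣p∣ a)
   , N
   , λ n n≥ → begin
     ∣ seq x n ∣
       ≡⟨ cong ∣_∣ (split (seq x n) a) ⟩
     ∣ (seq x n ℚ.- a) ℚ.+ a ∣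
       ≤⟨ ℚ.∣p+q∣≤∣p∣+∣q∣ (seq x n ℚ.- a) a ⟩
     ∣ seq x n ℚ.- a ∣ ℚ.+ ∣ a ∣
       ≤⟨ ℚ.+-monoˡ-≤ ∣ a ∣ (ℚ.<⇒≤ (p n N n≥ ℕ.≤-refl)) ⟩
     1ℚ ℚ.+ ∣ a ∣ ∎
  where
  open ℚ.≤-Reasoning
  split : ∀ a b → a ≡ (a ℚ.- b) ℚ.+ b
  split = solve 2 (λ a b → a := (a :- b) :+ b) refl
    where open ℚ-Solver

_*_ : ℝ → ℝ → ℝ
x * y = mkℝ (λ n → seq x n ℚ.* seq y n) λ ε 0<ε →
  let K , 0<K , K₀ , bx = eventually-bounded x
      L , 0<L , L₀ , by = eventually-bounded y
      instance
        K+  = ℚ.positive 0<K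
        L+  = ℚ.positive 0<L
        K≢0 = ℚ.>-nonZero 0<K
        L≢0 = ℚ.>-nonZero 0<L
        1/K+ = ℚ.1/pos⇒pos K
        1/L+ = ℚ.1/pos⇒pos L
      M , p = cauchy x (½ ℚ.* ε ℚ.* ℚ.1/ L)
                (*-pos (half-pos 0<ε) (ℚ.positive⁻¹ (ℚ.1/ L)))
      N , q = cauchy y (½ ℚ.* ε ℚ.* ℚ.1/ K)
                (*-pos (half-pos 0<ε) (ℚ.positive⁻¹ (ℚ.1/ K)))
      J     = K₀ ℕ.⊔ L₀
      P     = M ℕ.⊔ N
  in J ℕ.⊔ P , λ m n m≥ n≥ →
     let m≥J = ℕ.m⊔n≤o⇒m≤o J P m≥
         m≥P = ℕ.m⊔n≤o⇒n≤o J P m≥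
         n≥J = ℕ.m⊔n≤o⇒m≤o J P n≥
         n≥P = ℕ.m⊔n≤o⇒n≤o J P n≥
         dx  = seq x m ℚ.- seq x n
         dy  = seq y m ℚ.- seq y n
     in begin-strict
       ∣ seq x m ℚ.* seq y m ℚ.- seq x n ℚ.* seq y n ∣
         ≡⟨ cong ∣_∣ (regroup (seq x m) (seq y m) (seq x n) (seq y n)) ⟩
       ∣ dx ℚ.* seq y n ℚ.+ dy ℚ.* seq x m ∣
         ≤⟨ ℚ.∣p+q∣≤∣p∣+∣q∣ (dx ℚ.* seq y n) (dy ℚ.* seq x m) ⟩
       ∣ dx ℚ.* seq y n ∣ ℚ.+ ∣ dy ℚ.* seq x m ∣
         ≡⟨ cong₂ ℚ._+_ (ℚ.∣p*q∣≡∣p∣*∣q∣ dx (seq y n)) (ℚ.∣p*q∣≡∣p∣*∣q∣ dy (seq x m)) ⟩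
       ∣ dx ∣ ℚ.* ∣ seq y n ∣ ℚ.+ ∣ dy ∣ ℚ.* ∣ seq x m ∣
         ≤⟨ ℚ.+-mono-≤
              (*-mono-≤-nonNeg (ℚ.0≤∣p∣ dx) (ℚ.<⇒≤ 0<L) ℚ.≤-refl
                (by n (ℕ.m⊔n≤o⇒n≤o K₀ L₀ n≥J)))
              (*-mono-≤-nonNeg (ℚ.0≤∣p∣ dy) (ℚ.<⇒≤ 0<K) ℚ.≤-refl
                (bx m (ℕ.m⊔n≤o⇒m≤o K₀ L₀ m≥J))) ⟩
       ∣ dx ∣ ℚ.* L ℚ.+ ∣ dy ∣ ℚ.* K
         <⟨ ℚ.+-mono-<
              (ℚ.*-monoˡ-<-pos L (p m n (ℕ.m⊔n≤o⇒m≤o M N m≥P) (ℕ.m⊔n≤o⇒m≤o M N n≥P)))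
              (ℚ.*-monoˡ-<-pos K (q m n (ℕ.m⊔n≤o⇒n≤o M N m≥P) (ℕ.m⊔n≤o⇒n≤o M N n≥P))) ⟩
       ½ ℚ.* ε ℚ.* ℚ.1/ L ℚ.* L ℚ.+ ½ ℚ.* ε ℚ.* ℚ.1/ K ℚ.* K
         ≡⟨ cong₂ ℚ._+_ (cancel (½ ℚ.* ε) L) (cancel (½ ℚ.* ε) K) ⟩
       ½ ℚ.* ε ℚ.+ ½ ℚ.* ε
         ≡⟨ half+half ε ⟩
       ε ∎
  where
  open ℚ.≤-Reasoning
  regroup : ∀ a b c d → a ℚ.* b ℚ.- c ℚ.* d ≡ (a ℚ.- c) ℚ.* d ℚ.+ (b ℚ.- d) ℚ.* a
  regroup = solve 4 (λ a b c d → a :* b :- c :* d := (a :- c) :* d :+ (b :- d) :* a) refl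
    where open ℚ-Solver
  cancel : ∀ a b .{{_ : ℚ.NonZero b}} → a ℚ.* ℚ.1/ b ℚ.* b ≡ a
  cancel a b = trans (ℚ.*-assoc a (ℚ.1/ b) b)
    (trans (cong (a ℚ.*_) (ℚ.*-inverseˡ b)) (ℚ.*-identityʳ a))

isqrt : ℕ → ℕ
isqrt zero    = 0
isqrt (suc n) with suc (isqrt n) ℕ.* suc (isqrt n) ℕ.≤? suc n
... | yes _ = suc (isqrt n)
... | no  _ = isqrt n

isqrt-lower : ∀ n → isqrt n ℕ.* isqrt n ℕ.≤ n
isqrt-lower zero    = ℕ.z≤n
isqrt-lower (suc n) with suc (isqrt n) ℕ.* suc (isqrt n) ℕ.≤? suc n
... | yes p = p
... | no  _ = ℕ.m≤n⇒m≤1+n (isqrt-lower n)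

isqrt-upper : ∀ n → n ℕ.< suc (isqrt n) ℕ.* suc (isqrt n)
isqrt-upper zero    = ℕ.s≤s ℕ.z≤n
isqrt-upper (suc n) with suc (isqrt n) ℕ.* suc (isqrt n) ℕ.≤? suc n
... | yes _ = ℕ.≤-<-trans (isqrt-upper n)
                (ℕ.*-mono-< (ℕ.n<1+n (suc (isqrt n))) (ℕ.n<1+n (suc (isqrt n))))
... | no ¬p = ℕ.≰⇒> ¬p

ι : ℕ → ℚ
ι n = + n ℚ./ 1

δ : ℕ → ℚ
δ m = + 1 ℚ./ suc m

-- The m-th approximation to √ n is ⌊ √ (n (m + 1)²) ⌋ / (m + 1).
√-seq : ℕ → ℕ → ℚ
√-seq n m = + isqrt (n ℕ.* (suc m ℕ.* suc m)) ℚ./ suc m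

toℚᵘ-/ : ∀ i m → ℚ.toℚᵘ (i ℚ./ suc m) ℚᵘ.≃ ℚᵘ.mkℚᵘ i m
toℚᵘ-/ i m = ℚ.toℚᵘ-fromℚᵘ (ℚᵘ.mkℚᵘ i m)

/-mono-≤ : ∀ i j m n → i ℤ.* + suc n ℤ.≤ j ℤ.* + suc m →
           i ℚ./ suc m ℚ.≤ j ℚ./ suc n
/-mono-≤ i j m n h = ℚ.toℚᵘ-cancel-≤
  (ℚᵘ.≤-respˡ-≃ (ℚᵘ.≃-sym (toℚᵘ-/ i m))
    (ℚᵘ.≤-respʳ-≃ (ℚᵘ.≃-sym (toℚᵘ-/ j n)) (ℚᵘ.*≤* h)))

/-mono-< : ∀ i j m n → i ℤ.* + suc n ℤ.< j ℤ.* + suc m →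
           i ℚ./ suc m ℚ.< j ℚ./ suc n
/-mono-< i j m n h = ℚ.toℚᵘ-cancel-<
  (ℚᵘ.<-respˡ-≃ (ℚᵘ.≃-sym (toℚᵘ-/ i m))
    (ℚᵘ.<-respʳ-≃ (ℚᵘ.≃-sym (toℚᵘ-/ j n)) (ℚᵘ.*<* h)))

ι-mono-≤ : ∀ {m n} → m ℕ.≤ n → ι m ℚ.≤ ι n
ι-mono-≤ {m} {n} h = /-mono-≤ (+ m) (+ n) 0 0 (ℤ.*-monoʳ-≤-nonNeg (+ 1) (ℤ.+≤+ h))

ι-mono-< : ∀ {m n} → m ℕ.< n → ι m ℚ.< ι n
ι-mono-< {m} {n} h = /-mono-< (+ m) (+ n) 0 0 (ℤ.*-monoʳ-<-pos (+ 1) (ℤ.+<+ h))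

ι-homo-+ : ∀ m n → ι (m ℕ.+ n) ≡ ι m ℚ.+ ι n
ι-homo-+ m n = ℚ.toℚᵘ-injective (ℚᵘ.≃-trans (toℚᵘ-/ (+ (m ℕ.+ n)) 0)
  (ℚᵘ.≃-trans (ℚᵘ.*≡* (cong (λ z → z ℤ.* + 1)
    (sym (cong₂ ℤ._+_ (ℤ.*-identityʳ (+ m)) (ℤ.*-identityʳ (+ n))))))
  (ℚᵘ.≃-sym (ℚᵘ.≃-trans (ℚ.toℚᵘ-homo-+ (ι m) (ι n))
    (ℚᵘ.+-cong (toℚᵘ-/ (+ m) 0) (toℚᵘ-/ (+ n) 0))))))

ι-homo-* : ∀ m n → ι (m ℕ.* n) ≡ ι m ℚ.* ι n
ι-homo-* m n = ℚ.toℚᵘ-injective (ℚᵘ.≃-trans (toℚᵘ-/ (+ (m ℕ.* n)) 0)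
  (ℚᵘ.≃-trans (ℚᵘ.*≡* (cong (λ z → z ℤ.* + 1) (ℤ.pos-* m n)))
  (ℚᵘ.≃-sym (ℚᵘ.≃-trans (ℚ.toℚᵘ-homo-* (ι m) (ι n))
    (ℚᵘ.*-cong (toℚᵘ-/ (+ m) 0) (toℚᵘ-/ (+ n) 0))))))

/≡ι*δ : ∀ s m → + s ℚ./ suc m ≡ ι s ℚ.* δ m
/≡ι*δ s m = ℚ.toℚᵘ-injective (ℚᵘ.≃-trans (toℚᵘ-/ (+ s) m)
  (ℚᵘ.≃-trans (ℚᵘ.*≡* (cong₂ ℤ._*_ (sym (ℤ.*-identityʳ (+ s)))
      (cong +_ (cong suc (ℕ.+-identityʳ m)))))
  (ℚᵘ.≃-sym (ℚᵘ.≃-trans (ℚ.toℚᵘ-homo-* (ι s) (δ m))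
    (ℚᵘ.*-cong (toℚᵘ-/ (+ s) 0) (toℚᵘ-/ (+ 1) m))))))

ι*δ≡1 : ∀ m → ι (suc m) ℚ.* δ m ≡ 1ℚ
ι*δ≡1 m = trans (sym (/≡ι*δ (suc m) m))
  (ℚ.toℚᵘ-injective (ℚᵘ.≃-trans (toℚᵘ-/ (+ suc m) m)
    (ℚᵘ.*≡* (ℤ.*-comm (+ suc m) (+ 1)))))

δ-pos : ∀ m → 0ℚ ℚ.< δ m
δ-pos m = /-mono-< (+ 0) (+ 1) 0 m (ℤ.+<+ (ℕ.s≤s ℕ.z≤n))

δ-anti : ∀ {m n} → m ℕ.≤ n → δ n ℚ.≤ δ m
δ-anti {m} {n} h = /-mono-≤ (+ 1) (+ 1) n m (ℤ.*-monoˡ-≤-nonNeg (+ 1) (ℤ.+≤+ (ℕ.s≤s h)))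

archimedean : ∀ ε → 0ℚ ℚ.< ε → ∃ λ N → δ N ℚ.≤ ε
archimedean ε@(mkℚ (+ suc p) d _) _ = d , subst (δ d ℚ.≤_) (ℚ.↥p/↧p≡p ε)
  (/-mono-≤ (+ 1) (+ suc p) d d (ℤ.*-monoʳ-≤-nonNeg (+ suc d) {+ 1} {+ suc p} (ℤ.+≤+ (ℕ.s≤s ℕ.z≤n))))
archimedean (mkℚ (+ zero) _ _)    (ℚ.*<* (ℤ.+<+ ()))
archimedean (mkℚ ℤ.-[1+ _ ] _ _) (ℚ.*<* ())

ι-pos*δ² : ∀ n m → ι (n ℕ.* (suc m ℕ.* suc m)) ℚ.* (δ m ℚ.* δ m) ≡ ι n
ι-pos*δ² n m = begin
  ι (n ℕ.* (suc m ℕ.* suc m)) ℚ.* (δ m ℚ.* δ m)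
    ≡⟨ cong (ℚ._* (δ m ℚ.* δ m)) (trans (ι-homo-* n (suc m ℕ.* suc m))
         (cong (ι n ℚ.*_) (ι-homo-* (suc m) (suc m)))) ⟩
  ι n ℚ.* (ι (suc m) ℚ.* ι (suc m)) ℚ.* (δ m ℚ.* δ m)
    ≡⟨ regroup (ι n) (ι (suc m)) (δ m) ⟩
  ι n ℚ.* (ι (suc m) ℚ.* δ m) ℚ.* (ι (suc m) ℚ.* δ m)
    ≡⟨ cong (λ u → ι n ℚ.* u ℚ.* u) (ι*δ≡1 m) ⟩
  ι n ℚ.* 1ℚ ℚ.* 1ℚ
    ≡⟨ trans (ℚ.*-identityʳ (ι n ℚ.* 1ℚ)) (ℚ.*-identityʳ (ι n)) ⟩
  ι n ∎
  where
  open Relation.Binary.PropositionalEquality.≡-Reasoning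
  regroup : ∀ a b c → a ℚ.* (b ℚ.* b) ℚ.* (c ℚ.* c) ≡ a ℚ.* (b ℚ.* c) ℚ.* (b ℚ.* c)
  regroup = solve 3 (λ a b c → a :* (b :* b) :* (c :* c) := a :* (b :* c) :* (b :* c)) refl
    where open ℚ-Solver

*-δ²-mono-≤ : ∀ m {p q} → p ℚ.≤ q → p ℚ.* (δ m ℚ.* δ m) ℚ.≤ q ℚ.* (δ m ℚ.* δ m)
*-δ²-mono-≤ m = ℚ.*-monoʳ-≤-nonNeg (δ m ℚ.* δ m)
  {{ℚ.nonNegative (ℚ.<⇒≤ (*-pos (δ-pos m) (δ-pos m)))}}

*-δ²-mono-< : ∀ m {p q} → p ℚ.< q → p ℚ.* (δ m ℚ.* δ m) ℚ.< q ℚ.* (δ m ℚ.* δ m)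
*-δ²-mono-< m = ℚ.*-monoˡ-<-pos (δ m ℚ.* δ m)
  {{ℚ.positive (*-pos (δ-pos m) (δ-pos m))}}

√-seq-nonNeg : ∀ n m → 0ℚ ℚ.≤ √-seq n m
√-seq-nonNeg n m = /-mono-≤ (+ 0) (+ isqrt (n ℕ.* (suc m ℕ.* suc m))) 0 m
  (ℤ.*-monoʳ-≤-nonNeg (+ 1) {+ 0} {+ isqrt (n ℕ.* (suc m ℕ.* suc m))} (ℤ.+≤+ ℕ.z≤n))

√-seq-lower : ∀ n m → √-seq n m ℚ.* √-seq n m ℚ.≤ ι n
√-seq-lower n m = begin
  √-seq n m ℚ.* √-seq n m
    ≡⟨ cong (λ u → u ℚ.* u) (/≡ι*δ s m) ⟩
  ι s ℚ.* δ m ℚ.* (ι s ℚ.* δ m)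
    ≡⟨ regroup (ι s) (δ m) ⟩
  ι s ℚ.* ι s ℚ.* (δ m ℚ.* δ m)
    ≡⟨ cong (ℚ._* (δ m ℚ.* δ m)) (sym (ι-homo-* s s)) ⟩
  ι (s ℕ.* s) ℚ.* (δ m ℚ.* δ m)
    ≤⟨ *-δ²-mono-≤ m (ι-mono-≤ (isqrt-lower (n ℕ.* (suc m ℕ.* suc m)))) ⟩
  ι (n ℕ.* (suc m ℕ.* suc m)) ℚ.* (δ m ℚ.* δ m)
    ≡⟨ ι-pos*δ² n m ⟩
  ι n ∎
  where
  open ℚ.≤-Reasoning
  s = isqrt (n ℕ.* (suc m ℕ.* suc m))
  regroup : ∀ a b → a ℚ.* b ℚ.* (a ℚ.* b) ≡ a ℚ.* a ℚ.* (b ℚ.* b)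
  regroup = solve 2 (λ a b → a :* b :* (a :* b) := a :* a :* (b :* b)) refl
    where open ℚ-Solver

√-seq-upper : ∀ n m → ι n ℚ.< (√-seq n m ℚ.+ δ m) ℚ.* (√-seq n m ℚ.+ δ m)
√-seq-upper n m = begin-strict
  ι n
    ≡⟨ sym (ι-pos*δ² n m) ⟩
  ι (n ℕ.* (suc m ℕ.* suc m)) ℚ.* (δ m ℚ.* δ m)
    <⟨ *-δ²-mono-< m (ι-mono-< (isqrt-upper (n ℕ.* (suc m ℕ.* suc m)))) ⟩
  ι (suc s ℕ.* suc s) ℚ.* (δ m ℚ.* δ m)
    ≡⟨ cong (ℚ._* (δ m ℚ.* δ m)) (trans (ι-homo-* (suc s) (suc s))
         (cong (λ u → u ℚ.* u) (ι-homo-+ 1 s))) ⟩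
  (1ℚ ℚ.+ ι s) ℚ.* (1ℚ ℚ.+ ι s) ℚ.* (δ m ℚ.* δ m)
    ≡⟨ regroup (ι s) (δ m) ⟩
  (ι s ℚ.* δ m ℚ.+ δ m) ℚ.* (ι s ℚ.* δ m ℚ.+ δ m)
    ≡⟨ cong (λ u → (u ℚ.+ δ m) ℚ.* (u ℚ.+ δ m)) (sym (/≡ι*δ s m)) ⟩
  (√-seq n m ℚ.+ δ m) ℚ.* (√-seq n m ℚ.+ δ m) ∎
  where
  open ℚ.≤-Reasoning
  s = isqrt (n ℕ.* (suc m ℕ.* suc m))
  regroup : ∀ a b → (1ℚ ℚ.+ a) ℚ.* (1ℚ ℚ.+ a) ℚ.* (b ℚ.* b) ≡
                    (a ℚ.* b ℚ.+ b) ℚ.* (a ℚ.* b ℚ.+ b)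
  regroup = solve 2 (λ a b → (con 1ℚ :+ a) :* (con 1ℚ :+ a) :* (b :* b) :=
                             (a :* b :+ b) :* (a :* b :+ b)) refl
    where open ℚ-Solver

√-seq-close : ∀ n m k → √-seq n m ℚ.< √-seq n k ℚ.+ δ k
√-seq-close n m k with √-seq n m ℚ.<? √-seq n k ℚ.+ δ k
... | yes h = h
... | no ¬h = contradiction (ℚ.<-≤-trans (√-seq-upper n k)
    (ℚ.≤-trans (*-mono-≤-nonNeg b≥0 (√-seq-nonNeg n m) b≤a b≤a) (√-seq-lower n m)))
    (ℚ.<-irrefl refl)
  where
  b≤a = ℚ.≮⇒≥ ¬h
  b≥0 = ℚ.+-mono-≤ (√-seq-nonNeg n k) (ℚ.<⇒≤ (δ-pos k))

<+⇒-< : ∀ {p q r} → p ℚ.< q ℚ.+ r → p ℚ.- q ℚ.< r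
<+⇒-< {p} {q} {r} h = subst (p ℚ.- q ℚ.<_) (cancel q r) (ℚ.+-monoˡ-< (ℚ.- q) h)
  where
  cancel : ∀ q r → q ℚ.+ r ℚ.- q ≡ r
  cancel = solve 2 (λ q r → q :+ r :- q := r) refl
    where open ℚ-Solver

flip-- : ∀ p q → ℚ.- (p ℚ.- q) ≡ q ℚ.- p
flip-- = solve 2 (λ p q → :- (p :- q) := q :- p) refl
  where open ℚ-Solver

∣-∣-< : ∀ {p q r} → p ℚ.- q ℚ.< r → q ℚ.- p ℚ.< r → ∣ p ℚ.- q ∣ ℚ.< r
∣-∣-< {p} {q} {r} h₁ h₂ with ℚ.∣p∣≡p∨∣p∣≡-p (p ℚ.- q)
... | inj₁ e = subst (ℚ._< r) (sym e) h₁
... | inj₂ e = subst (ℚ._< r) (sym (trans e (flip-- p q))) h₂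

√ : ℕ → ℝ
√ n = mkℝ (√-seq n) λ ε 0<ε →
  let N , δN≤ε = archimedean ε 0<ε
  in N , λ m k m≥ k≥ → ∣-∣-< {√-seq n m} {√-seq n k}
    (ℚ.<-≤-trans (<+⇒-< {√-seq n m} (√-seq-close n m k)) (ℚ.≤-trans (δ-anti k≥) δN≤ε))
    (ℚ.<-≤-trans (<+⇒-< {√-seq n k} (√-seq-close n k m)) (ℚ.≤-trans (δ-anti m≥) δN≤ε))

√-nonNeg : ∀ n → 0ℝ ≤ √ n
√-nonNeg n (ε , 0<ε , N , h) = ℚ.<-irrefl refl
  (ℚ.<-trans (ℚ.+-mono-≤-< (√-seq-nonNeg n N) 0<ε) (h N ℕ.≤-refl))

√-seq-≤ : ∀ n m → √-seq n m ℚ.≤ ι (suc n)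
√-seq-≤ n m with √-seq n m ℚ.≤? ι (suc n)
... | yes h = h
... | no ¬h = contradiction (begin-strict
    ι n                         <⟨ ι-mono-< {n} {suc n ℕ.* suc n} (ℕ.m≤m+n (suc n) (n ℕ.* suc n)) ⟩
    ι (suc n ℕ.* suc n)         ≡⟨ ι-homo-* (suc n) (suc n) ⟩
    ι (suc n) ℚ.* ι (suc n)     ≤⟨ *-mono-≤-nonNeg (ι-mono-≤ {0} {suc n} ℕ.z≤n) (√-seq-nonNeg n m) b≤a b≤a ⟩
    √-seq n m ℚ.* √-seq n m     ≤⟨ √-seq-lower n m ⟩
    ι n                         ∎) (ℚ.<-irrefl refl)
  where
  open ℚ.≤-Reasoning
  b≤a = ℚ.<⇒≤ (ℚ.≰⇒> ¬h)

√-square : ∀ n → √ n * √ n ≈ fromℕ n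
√-square n ε 0<ε =
  let K      = suc n ℕ.+ suc n
      N , δN = archimedean (ε ℚ.* δ K) (*-pos 0<ε (δ-pos K))
  in N , λ m m≥ →
     let a = √-seq n m
     in ∣-∣-< {a ℚ.* a} {ι n}
       (ℚ.≤-<-trans (subst (a ℚ.* a ℚ.- ι n ℚ.≤_) (ℚ.+-inverseʳ (ι n))
          (ℚ.+-monoˡ-≤ (ℚ.- ι n) (√-seq-lower n m))) 0<ε)
       (<+⇒-< {ι n} {a ℚ.* a} (begin-strict
         ι n
           <⟨ √-seq-upper n m ⟩
         (a ℚ.+ δ m) ℚ.* (a ℚ.+ δ m)
           ≡⟨ expand a (δ m) ⟩
         a ℚ.* a ℚ.+ (δ m ℚ.+ (a ℚ.+ a)) ℚ.* δ m
           ≤⟨ ℚ.+-monoʳ-≤ (a ℚ.* a) (*-mono-≤-nonNeg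
                (ℚ.+-mono-≤ (ℚ.<⇒≤ (δ-pos m)) (ℚ.+-mono-≤ (√-seq-nonNeg n m) (√-seq-nonNeg n m)))
                (ℚ.<⇒≤ (*-pos 0<ε (δ-pos K)))
                (ℚ.+-mono-≤ (δ-anti {0} {m} ℕ.z≤n) (ℚ.+-mono-≤ (√-seq-≤ n m) (√-seq-≤ n m)))
                (ℚ.≤-trans (δ-anti m≥) δN)) ⟩
         a ℚ.* a ℚ.+ (ι 1 ℚ.+ (ι (suc n) ℚ.+ ι (suc n))) ℚ.* (ε ℚ.* δ K)
           ≡⟨ cong (λ u → a ℚ.* a ℚ.+ u ℚ.* (ε ℚ.* δ K))
                (sym (trans (ι-homo-+ 1 K) (cong (ι 1 ℚ.+_) (ι-homo-+ (suc n) (suc n))))) ⟩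
         a ℚ.* a ℚ.+ ι (suc K) ℚ.* (ε ℚ.* δ K)
           ≡⟨ cong (a ℚ.* a ℚ.+_) (swap (ι (suc K)) ε (δ K)) ⟩
         a ℚ.* a ℚ.+ ε ℚ.* (ι (suc K) ℚ.* δ K)
           ≡⟨ cong (λ u → a ℚ.* a ℚ.+ ε ℚ.* u) (ι*δ≡1 K) ⟩
         a ℚ.* a ℚ.+ ε ℚ.* 1ℚ
           ≡⟨ cong (a ℚ.* a ℚ.+_) (ℚ.*-identityʳ ε) ⟩
         a ℚ.* a ℚ.+ ε ∎))
  where
  open ℚ.≤-Reasoning
  expand : ∀ a d → (a ℚ.+ d) ℚ.* (a ℚ.+ d) ≡ a ℚ.* a ℚ.+ (d ℚ.+ (a ℚ.+ a)) ℚ.* d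
  expand = solve 2 (λ a d → (a :+ d) :* (a :+ d) := a :* a :+ (d :+ (a :+ a)) :* d) refl
    where open ℚ-Solver
  swap : ∀ a b c → a ℚ.* (b ℚ.* c) ≡ b ℚ.* (a ℚ.* c)
  swap = solve 3 (λ a b c → a :* (b :* c) := b :* (a :* c)) refl
    where open ℚ-Solver

-- A listing determines P on all of ℝ, so P automatically respects _≈_.
_Lists_ : ∀ {n} → (Fin n → ℝ) → Pred ℝ 0ℓ → Set
e Lists P = ∀ x → P x ⇔ ∃ λ i → x ≈ e i

HasSize : Pred ℝ 0ℓ → ℕ → Set
HasSize P n = ∃ λ (e : Fin n → ℝ) → Injective _≡_ _≈_ e × e Lists P

infixl 6 _⊕_

_⊕_ : Pred ℝ 0ℓ → Pred ℝ 0ℓ → Pred ℝ 0ℓ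
(A ⊕ B) x = ∃₂ λ a b → A a × B b × x ≈ a + b

StrictlyIncreasing : ∀ {k} → (Fin k → ℝ) → Set
StrictlyIncreasing a = ∀ {i j} → i Fin.< j → a i < a j

-- The primed indices are the successors of the unprimed ones, so the
-- differences range over exactly the k - 1 consecutive pairs.
DistinctConsecutiveDifferences : Pred ℝ 0ℓ → Set
DistinctConsecutiveDifferences A =
  ∃₂ λ k (a : Fin k → ℝ) → StrictlyIncreasing a × a Lists A ×
    (∀ {i i′ j j′} → toℕ i′ ≡ suc (toℕ i) → toℕ j′ ≡ suc (toℕ j) →
      a i′ - a i ≈ a j′ - a j → i ≡ j)

{-# OPTIONS --safe #-}

-- List C = A + B and replace each a_i + b by its rank in C.  For a fixed b the
-- gaps between the ranks of a_i + b and a_{i+1} + b add up to less than n = |C|,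
-- so most of the (k - 1) l pairs (i , b) have a gap of at most about 2n / k.  The
-- rank of a_i + b and the gap determine a_{i+1} - a_i, hence i, hence b, so there
-- are at most about n · (2n / k) such pairs; thus k² l = O(n²).
--
-- The order on C is not decidable, but it is decidable under a double negation,
-- which the conclusion k² l ≤ 25 n², being decidable, absorbs.

module Submission where

open import Defs
open import Data.Fin as Fin using (Fin; zero; suc; toℕ; inject₁; fromℕ<; combine)
import Data.Fin.Properties as Fin
open import Data.Integer using (+_)
open import Data.List using (List; []; _∷_; _++_; length; map; filter; lookup; tabulate; allFin; cartesianProduct)
open import Data.List.Membership.Propositional using (_∈_)
open import Data.List.Membership.Propositional.Properties using (∈-lookup; ∈-filter⁻; ∈-allFin)
open import Data.List.Properties
  using (filter-notAll; length-++; length-map; length-tabulate; map-∘; map-tabulate; map-++)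
open import Data.List.Relation.Unary.All as All using ()
open import Data.List.Relation.Unary.AllPairs using (_∷_)
open import Data.List.Relation.Unary.Any as Any using (here; there)
open import Data.List.Relation.Unary.Unique.Propositional using (Unique)
import Data.List.Relation.Unary.Unique.Propositional.Properties as Unique
open import Data.Nat using (ℕ; zero; suc; _^_)
import Data.Nat as ℕ
import Data.Nat.Properties as ℕ
open import Data.Nat.DivMod using (_/_; _%_; m≡m%n+[m/n]*n; m%n<n; m/n*n≤m)
open import Data.Nat.ListAction using (sum)
open import Data.Nat.ListAction.Properties using (sum-++)
open import Data.Nat.Solver using () renaming (module +-*-Solver to ℕ-Solver)
open import Data.Product using (∃; _×_; _,_; proj₁; proj₂)
open import Data.Rational as ℚ using (ℚ; 0ℚ; 1ℚ; ½; ∣_∣)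
import Data.Rational.Properties as ℚ
open import Data.Rational.Solver using () renaming (module +-*-Solver to ℚ-Solver)
open import Data.Sum using (inj₁; inj₂)
open import Effect.Monad using (RawMonad)
open import Function using (Injective; Equivalence; _∘_)
open import Level using (0ℓ)
open import Relation.Binary using (tri<; tri≈; tri>)
open import Relation.Binary.PropositionalEquality
  using (_≡_; refl; sym; trans; cong; cong₂; subst)
open import Relation.Nullary using (¬_; Dec; yes; no; contradiction)
open import Relation.Nullary.Decidable using (decidable-stable; ¬¬-excluded-middle; from-yes)
open import Relation.Nullary.Negation using (¬¬-Monad; ¬¬-map)
open import Relation.Unary using (Pred; Decidable; Satisfiable)

-- Counting in ℕ

module _ {A : Set} where

  -- Turns a duplicate-free list into an injection from `Fin`, so that pigeonhole bounds its length.
  lookup-injective : ∀ {xs : List A} → Unique xs → Injective _≡_ _≡_ (lookup xs)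
  lookup-injective (_ ∷ _)     {zero}  {zero}  _ = refl
  lookup-injective (x∉xs ∷ _)  {zero}  {suc j} e = contradiction e (All.lookup x∉xs (∈-lookup j))
  lookup-injective (x∉xs ∷ _)  {suc i} {zero}  e = contradiction (sym e) (All.lookup x∉xs (∈-lookup i))
  lookup-injective (_ ∷ xs!)   {suc i} {suc j} e = cong suc (lookup-injective xs! e)

  length-filter-mono-≤ : ∀ {P Q : Pred A 0ℓ} (P? : Decidable P) (Q? : Decidable Q) →
    (∀ {x} → P x → Q x) → ∀ xs → length (filter P? xs) ℕ.≤ length (filter Q? xs)
  length-filter-mono-≤ P? Q? P⊆Q [] = ℕ.z≤n
  length-filter-mono-≤ P? Q? P⊆Q (x ∷ xs) with P? x | Q? x
  ... | yes p | yes _ = ℕ.s≤s (length-filter-mono-≤ P? Q? P⊆Q xs)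
  ... | yes p | no ¬q = contradiction (P⊆Q p) ¬q
  ... | no _  | yes _ = ℕ.m≤n⇒m≤1+n (length-filter-mono-≤ P? Q? P⊆Q xs)
  ... | no _  | no _  = length-filter-mono-≤ P? Q? P⊆Q xs

  length-filter-mono-< : ∀ {P Q : Pred A 0ℓ} (P? : Decidable P) (Q? : Decidable Q) →
    (∀ {x} → P x → Q x) → ∀ {x xs} → x ∈ xs → ¬ P x → Q x →
    length (filter P? xs) ℕ.< length (filter Q? xs)
  length-filter-mono-< P? Q? P⊆Q {x} {.x ∷ xs} (here refl) ¬p q with P? x | Q? x
  ... | yes p | _     = contradiction p ¬p
  ... | no _  | yes _ = ℕ.s≤s (length-filter-mono-≤ P? Q? P⊆Q xs)
  ... | no _  | no ¬q = contradiction q ¬q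
  length-filter-mono-< P? Q? P⊆Q {xs = y ∷ xs} (there x∈) ¬p q with P? y | Q? y
  ... | yes p | yes _  = ℕ.s≤s (length-filter-mono-< P? Q? P⊆Q x∈ ¬p q)
  ... | yes p | no ¬q′ = contradiction (P⊆Q p) ¬q′
  ... | no _  | yes _  = ℕ.m≤n⇒m≤1+n (length-filter-mono-< P? Q? P⊆Q x∈ ¬p q)
  ... | no _  | no _   = length-filter-mono-< P? Q? P⊆Q x∈ ¬p q

  -- Markov's inequality without division: an element with `u x` at least `T` pays for itself in the
  -- sum, and every other one is charged `T` in the last term.
  markov : ∀ (u : A → ℕ) T (short? : Decidable (λ x → u x ℕ.< T)) xs →
    T ℕ.* length xs ℕ.≤ sum (map u xs) ℕ.+ T ℕ.* length (filter short? xs)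
  markov u T short? [] = ℕ.≤-refl
  markov u T short? (x ∷ xs) with ih ← markov u T short? xs | short? x
  ... | yes _ = begin
    T ℕ.* suc (length xs)              ≡⟨ ℕ.*-suc T (length xs) ⟩
    T ℕ.+ T ℕ.* length xs              ≤⟨ ℕ.+-monoʳ-≤ T ih ⟩
    T ℕ.+ (S ℕ.+ T ℕ.* L)              ≤⟨ ℕ.m≤n+m _ (u x) ⟩
    u x ℕ.+ (T ℕ.+ (S ℕ.+ T ℕ.* L))    ≡⟨ solve 4 (λ a t s l → a :+ (t :+ (s :+ t :* l)) :=
                                            (a :+ s) :+ t :* (con 1 :+ l)) refl (u x) T S L ⟩
    (u x ℕ.+ S) ℕ.+ T ℕ.* suc L        ∎
    where
    open ℕ.≤-Reasoning
    open ℕ-Solver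
    S = sum (map u xs)
    L = length (filter short? xs)
  ... | no T≰u = begin
    T ℕ.* suc (length xs)              ≡⟨ ℕ.*-suc T (length xs) ⟩
    T ℕ.+ T ℕ.* length xs              ≤⟨ ℕ.+-mono-≤ (ℕ.≮⇒≥ T≰u) ih ⟩
    u x ℕ.+ (S ℕ.+ T ℕ.* L)            ≡⟨ sym (ℕ.+-assoc (u x) S _) ⟩
    (u x ℕ.+ S) ℕ.+ T ℕ.* L            ∎
    where
    open ℕ.≤-Reasoning
    S = sum (map u xs)
    L = length (filter short? xs)

length-cartesianProduct : ∀ {A B : Set} (xs : List A) (ys : List B) →
  length (cartesianProduct xs ys) ≡ length xs ℕ.* length ys
length-cartesianProduct []       ys = refl
length-cartesianProduct (x ∷ xs) ys = trans (length-++ (map (x ,_) ys))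
  (cong₂ ℕ._+_ (length-map (x ,_) ys) (length-cartesianProduct xs ys))

sum-cartesianProduct-≤ : ∀ {A B : Set} (u : A × B → ℕ) ys n →
  (∀ x → sum (map (λ y → u (x , y)) ys) ℕ.≤ n) →
  ∀ xs → sum (map u (cartesianProduct xs ys)) ℕ.≤ length xs ℕ.* n
sum-cartesianProduct-≤ u ys n h []       = ℕ.z≤n
sum-cartesianProduct-≤ u ys n h (x ∷ xs) = begin
  sum (map u (map (x ,_) ys ++ zs))             ≡⟨ cong sum (map-++ u (map (x ,_) ys) zs) ⟩
  sum (map u (map (x ,_) ys) ++ map u zs)       ≡⟨ sum-++ (map u (map (x ,_) ys)) (map u zs) ⟩
  sum (map u (map (x ,_) ys)) ℕ.+ sum (map u zs)          ≡⟨ cong (λ v → sum v ℕ.+ sum (map u zs)) (sym (map-∘ ys)) ⟩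
  sum (map (λ y → u (x , y)) ys) ℕ.+ sum (map u zs)       ≤⟨ ℕ.+-mono-≤ (h x) (sum-cartesianProduct-≤ u ys n h xs) ⟩
  n ℕ.+ length xs ℕ.* n                                   ∎
  where
  open ℕ.≤-Reasoning
  zs = cartesianProduct xs ys

-- Monotonicity makes each truncated subtraction exact. The summand `h zero` is carried along so
-- that the induction can absorb the first difference and pass to `h ∘ suc`.
telescope-≤ : ∀ m {n} (h : Fin (suc m) → ℕ) → (∀ i → h i ℕ.≤ n) →
  (∀ i → h (inject₁ i) ℕ.≤ h (suc i)) →
  h zero ℕ.+ sum (tabulate (λ i → h (suc i) ℕ.∸ h (inject₁ i))) ℕ.≤ n
telescope-≤ zero    {n} h h≤n mono = subst (ℕ._≤ n) (sym (ℕ.+-identityʳ (h zero))) (h≤n zero)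
telescope-≤ (suc m) {n} h h≤n mono = begin
  h zero ℕ.+ ((h (suc zero) ℕ.∸ h zero) ℕ.+ s)   ≡⟨ sym (ℕ.+-assoc (h zero) _ s) ⟩
  h zero ℕ.+ (h (suc zero) ℕ.∸ h zero) ℕ.+ s     ≡⟨ cong (ℕ._+ s) (ℕ.m+[n∸m]≡n (mono zero)) ⟩
  h (suc zero) ℕ.+ s                             ≤⟨ telescope-≤ m (h ∘ suc) (h≤n ∘ suc) (mono ∘ suc) ⟩
  n                                              ∎
  where
  open ℕ.≤-Reasoning
  s = sum (tabulate (λ i → h (suc (suc i)) ℕ.∸ h (inject₁ (suc i))))

-- Gaps between consecutive ranks.

-- g b i is to be read as the rank of a_i + b.
module _ {l m n} (g : Fin l → Fin (suc m) → ℕ)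
  (g<n : ∀ b i → g b i ℕ.< n)
  (g-mono : ∀ b i → g b (inject₁ i) ℕ.≤ g b (suc i))
  (g-inj : ∀ {b b′ i i′} → g b (inject₁ i) ≡ g b′ (inject₁ i′) → g b (suc i) ≡ g b′ (suc i′) →
           (b , i) ≡ (b′ , i′))
  where

  private
    gap : Fin l × Fin m → ℕ
    gap (b , i) = g b (suc i) ℕ.∸ g b (inject₁ i)

    pairs : List (Fin l × Fin m)
    pairs = cartesianProduct (allFin l) (allFin m)

    gap-determines : ∀ {p p′} → g (proj₁ p) (inject₁ (proj₂ p)) ≡ g (proj₁ p′) (inject₁ (proj₂ p′)) →
                     gap p ≡ gap p′ → p ≡ p′
    gap-determines {b , i} {b′ , i′} e f = g-inj e
      (trans (sym (ℕ.m+[n∸m]≡n (g-mono b i)))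
        (trans (cong₂ ℕ._+_ e f) (ℕ.m+[n∸m]≡n (g-mono b′ i′))))

  -- Pigeonhole: a short pair is coded by its starting rank, one of `n` values, and its gap, one of
  -- `T` values; together these recover the pair.
  short-gaps-≤ : ∀ T → length (filter (λ p → gap p ℕ.<? T) pairs) ℕ.≤ n ℕ.* T
  short-gaps-≤ T = Fin.injective⇒≤ {f = code} code-injective
    where
    short = filter (λ p → gap p ℕ.<? T) pairs

    short! : Unique short
    short! = Unique.filter⁺ (λ p → gap p ℕ.<? T)
      (Unique.cartesianProduct⁺ (Unique.allFin⁺ l) (Unique.allFin⁺ m))

    start<n : ∀ i → g (proj₁ (lookup short i)) (inject₁ (proj₂ (lookup short i))) ℕ.< n
    start<n i = g<n _ _

    gap<T : ∀ i → gap (lookup short i) ℕ.< T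
    gap<T i = proj₂ (∈-filter⁻ (λ p → gap p ℕ.<? T) {xs = pairs} (∈-lookup i))

    code : Fin (length short) → Fin (n ℕ.* T)
    code i = combine (fromℕ< (start<n i)) (fromℕ< (gap<T i))

    code-injective : Injective _≡_ _≡_ code
    code-injective {i} {j} e =
      let e₁ , e₂ = Fin.combine-injective (fromℕ< (start<n i)) (fromℕ< (gap<T i))
                                          (fromℕ< (start<n j)) (fromℕ< (gap<T j)) e
      in lookup-injective short! (gap-determines
           (Fin.fromℕ<-injective _ _ (start<n i) (start<n j) e₁)
           (Fin.fromℕ<-injective _ _ (gap<T i) (gap<T j) e₂))

  -- The gaps of one row add up to at most `n`, since its ranks increase and stay below `n`; the `l`
  -- rows together give the first term. The second charges `T` for each short pair.
  gaps-≤ : ∀ T → T ℕ.* (l ℕ.* m) ℕ.≤ l ℕ.* n ℕ.+ T ℕ.* (n ℕ.* T)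
  gaps-≤ T = begin
    T ℕ.* (l ℕ.* m)
      ≡⟨ cong (T ℕ.*_) (sym length-pairs) ⟩
    T ℕ.* length pairs
      ≤⟨ markov gap T (λ p → gap p ℕ.<? T) pairs ⟩
    sum (map gap pairs) ℕ.+ T ℕ.* length (filter (λ p → gap p ℕ.<? T) pairs)
      ≤⟨ ℕ.+-mono-≤ total-gap-≤ (ℕ.*-monoʳ-≤ T (short-gaps-≤ T)) ⟩
    l ℕ.* n ℕ.+ T ℕ.* (n ℕ.* T) ∎
    where
    open ℕ.≤-Reasoning
    length-allFin : ∀ k → length (allFin k) ≡ k
    length-allFin k = length-tabulate {n = k} (λ i → i)

    length-pairs : length pairs ≡ l ℕ.* m
    length-pairs = trans (length-cartesianProduct (allFin l) (allFin m))
      (cong₂ ℕ._*_ (length-allFin l) (length-allFin m))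

    row-gap-≤ : ∀ b → sum (map (λ i → gap (b , i)) (allFin m)) ℕ.≤ n
    row-gap-≤ b = subst (λ xs → sum xs ℕ.≤ n) (sym (map-tabulate {n = m} (λ i → i) (λ i → gap (b , i))))
      (ℕ.≤-trans (ℕ.m≤n+m _ (g b zero))
        (telescope-≤ m (g b) (λ i → ℕ.<⇒≤ (g<n b i)) (g-mono b)))

    total-gap-≤ : sum (map gap pairs) ℕ.≤ l ℕ.* n
    total-gap-≤ = subst (λ k → sum (map gap pairs) ℕ.≤ k ℕ.* n) (length-allFin l)
      (sum-cartesianProduct-≤ gap (allFin m) n row-gap-≤ (allFin l))

-- The threshold T = ⌊2n/m⌋ + 1 makes the long gaps account for at most half of
-- all pairs.
optimise-threshold : ∀ l m n .{{_ : ℕ.NonZero m}} → m ℕ.≤ n →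
  (∀ T → T ℕ.* (l ℕ.* m) ℕ.≤ l ℕ.* n ℕ.+ T ℕ.* (n ℕ.* T)) →
  m ℕ.* m ℕ.* l ℕ.≤ 6 ℕ.* (n ℕ.* n)
optimise-threshold l m n m≤n h = begin
  m ℕ.* m ℕ.* l                 ≡⟨ solve 2 (λ m l → m :* m :* l := m :* (l :* m)) refl m l ⟩
  m ℕ.* (l ℕ.* m)               ≤⟨ ℕ.*-monoʳ-≤ m lm≤2nT ⟩
  m ℕ.* (2 ℕ.* n ℕ.* T)         ≡⟨ solve 3 (λ m n t → m :* (con 2 :* n :* t) := con 2 :* n :* (t :* m)) refl m n T ⟩
  -- The quotient in `T` is rounded down, so `T * m` is at most `m + 2 * n`.
  2 ℕ.* n ℕ.* (T ℕ.* m)         ≤⟨ ℕ.*-monoʳ-≤ (2 ℕ.* n) (ℕ.+-mono-≤ m≤n (m/n*n≤m (2 ℕ.* n) m)) ⟩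
  2 ℕ.* n ℕ.* (n ℕ.+ 2 ℕ.* n)   ≡⟨ solve 1 (λ n → con 2 :* n :* (n :+ con 2 :* n) := con 6 :* (n :* n)) refl n ⟩
  6 ℕ.* (n ℕ.* n)               ∎
  where
  open ℕ.≤-Reasoning
  open ℕ-Solver
  T = suc (2 ℕ.* n / m)

  2n≤Tm : 2 ℕ.* n ℕ.≤ T ℕ.* m
  2n≤Tm = begin
    2 ℕ.* n                                       ≡⟨ m≡m%n+[m/n]*n (2 ℕ.* n) m ⟩
    2 ℕ.* n % m ℕ.+ 2 ℕ.* n / m ℕ.* m             ≤⟨ ℕ.+-monoˡ-≤ _ (ℕ.<⇒≤ (m%n<n (2 ℕ.* n) m)) ⟩
    T ℕ.* m                                       ∎

  -- The hypothesis is added to itself: the doubled first term is then at most `l * (T * m)`, which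
  -- cancels one of the two copies on the left and leaves a common factor `T`.
  lm≤2nT : l ℕ.* m ℕ.≤ 2 ℕ.* n ℕ.* T
  lm≤2nT = ℕ.*-cancelˡ-≤ T (ℕ.+-cancelˡ-≤ (T ℕ.* (l ℕ.* m)) _ _ (begin
    T ℕ.* (l ℕ.* m) ℕ.+ T ℕ.* (l ℕ.* m)
      ≤⟨ ℕ.+-mono-≤ (h T) (h T) ⟩
    (l ℕ.* n ℕ.+ T ℕ.* (n ℕ.* T)) ℕ.+ (l ℕ.* n ℕ.+ T ℕ.* (n ℕ.* T))
      ≡⟨ solve 3 (λ l n t → (l :* n :+ t :* (n :* t)) :+ (l :* n :+ t :* (n :* t))
           := l :* (con 2 :* n) :+ t :* (con 2 :* n :* t)) refl l n T ⟩
    l ℕ.* (2 ℕ.* n) ℕ.+ T ℕ.* (2 ℕ.* n ℕ.* T)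
      ≤⟨ ℕ.+-monoˡ-≤ _ (ℕ.*-monoʳ-≤ l 2n≤Tm) ⟩
    l ℕ.* (T ℕ.* m) ℕ.+ T ℕ.* (2 ℕ.* n ℕ.* T)
      ≡⟨ cong (ℕ._+ T ℕ.* (2 ℕ.* n ℕ.* T)) (solve 3 (λ l t m → l :* (t :* m) := t :* (l :* m)) refl l T m) ⟩
    T ℕ.* (l ℕ.* m) ℕ.+ T ℕ.* (2 ℕ.* n ℕ.* T) ∎))

-- For `k = m + 1` with `m` positive, the gap count gives m² l ≤ 6 n², and k ≤ 2m costs a factor 4.
-- The resulting 24 is raised to the perfect square 25, so that the final constant is the rational
-- 1/5.
injective-rows-bound : ∀ k l n (g : Fin l → Fin k → ℕ) →
  (∀ b i → g b i ℕ.< n) →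
  (∀ b {i j} → i Fin.< j → g b i ℕ.< g b j) →
  (∀ {b b′} i → g b i ≡ g b′ i → b ≡ b′) →
  (∀ {b b′ i i′ j j′} → toℕ i′ ≡ suc (toℕ i) → toℕ j′ ≡ suc (toℕ j) →
    g b i ≡ g b′ j → g b i′ ≡ g b′ j′ → i ≡ j) →
  k ℕ.* k ℕ.* l ℕ.≤ 25 ℕ.* (n ℕ.* n)
injective-rows-bound zero l n g g<n g-mono g-injˡ g-injᵈ = ℕ.z≤n
injective-rows-bound k zero n g g<n g-mono g-injˡ g-injᵈ =
  subst (ℕ._≤ 25 ℕ.* (n ℕ.* n)) (sym (ℕ.*-zeroʳ (k ℕ.* k))) ℕ.z≤n
-- A single column has no gaps, but its `l` entries are distinct numbers below `n`.
injective-rows-bound (suc zero) l@(suc _) n g g<n g-mono g-injˡ g-injᵈ = begin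
  1 ℕ.* 1 ℕ.* l         ≡⟨ ℕ.*-identityˡ l ⟩
  l                     ≤⟨ Fin.injective⇒≤ {f = λ b → fromℕ< (g<n b zero)} (λ {b} {b′} e →
                             g-injˡ zero (Fin.fromℕ<-injective _ _ (g<n b zero) (g<n b′ zero) e)) ⟩
  n                     ≤⟨ n≤n*n n ⟩
  n ℕ.* n               ≤⟨ ℕ.m≤n*m (n ℕ.* n) 25 ⟩
  25 ℕ.* (n ℕ.* n)      ∎
  where
  open ℕ.≤-Reasoning
  n≤n*n : ∀ n → n ℕ.≤ n ℕ.* n
  n≤n*n zero      = ℕ.z≤n
  n≤n*n n@(suc _) = ℕ.m≤m*n n n
injective-rows-bound k@(suc m@(suc m-1)) l@(suc _) n g g<n g-mono g-injˡ g-injᵈ = begin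
  k ℕ.* k ℕ.* l                        ≤⟨ ℕ.*-monoˡ-≤ l (ℕ.*-mono-≤ k≤2m k≤2m) ⟩
  (2 ℕ.* m) ℕ.* (2 ℕ.* m) ℕ.* l        ≡⟨ solve 2 (λ m l → (con 2 :* m) :* (con 2 :* m) :* l := con 4 :* (m :* m :* l)) refl m l ⟩
  4 ℕ.* (m ℕ.* m ℕ.* l)                ≤⟨ ℕ.*-monoʳ-≤ 4 (optimise-threshold l m n m≤n
                                            (gaps-≤ g g<n (λ b i → ℕ.<⇒≤ (g-mono b (inject₁<suc i))) g-inj)) ⟩
  4 ℕ.* (6 ℕ.* (n ℕ.* n))              ≡⟨ sym (ℕ.*-assoc 4 6 (n ℕ.* n)) ⟩
  24 ℕ.* (n ℕ.* n)                     ≤⟨ ℕ.m≤n+m (24 ℕ.* (n ℕ.* n)) (n ℕ.* n) ⟩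
  25 ℕ.* (n ℕ.* n)                     ∎
  where
  open ℕ.≤-Reasoning
  open ℕ-Solver
  k≤2m : k ℕ.≤ 2 ℕ.* m
  k≤2m = ℕ.+-mono-≤ (ℕ.s≤s {n = m-1} ℕ.z≤n) (ℕ.m≤m+n m 0)

  inject₁<suc : ∀ (i : Fin m) → inject₁ i Fin.< suc i
  inject₁<suc i = ℕ.≤-reflexive (cong suc (Fin.toℕ-inject₁ i))

  -- A row exists because `l` is positive, and its `m + 1` ranks increase strictly below `n`.
  m≤n : m ℕ.≤ n
  m≤n = ℕ.≤-trans (ℕ.n≤1+n m) (Fin.injective⇒≤ {f = λ i → fromℕ< (g<n zero i)} inj)
    where
    inj : Injective _≡_ _≡_ (λ i → fromℕ< (g<n zero i))
    inj {i} {j} e with e′ ← Fin.fromℕ<-injective _ _ (g<n zero i) (g<n zero j) e | ℕ.<-cmp (toℕ i) (toℕ j)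
    ... | tri< i<j _ _ = contradiction e′ (ℕ.<⇒≢ (g-mono zero i<j))
    ... | tri≈ _ i≡j _ = Fin.toℕ-injective i≡j
    ... | tri> _ _ j<i = contradiction (sym e′) (ℕ.<⇒≢ (g-mono zero j<i))

  -- Equal ranks at two consecutive positions first identify the columns, through `g-injᵈ`, and then
  -- the rows, through `g-injˡ`.
  g-inj : ∀ {b b′ i i′} → g b (inject₁ i) ≡ g b′ (inject₁ i′) → g b (suc i) ≡ g b′ (suc i′) →
          (b , i) ≡ (b′ , i′)
  g-inj {b} {b′} {i} {i′} e f
    with refl ← Fin.inject₁-injective (g-injᵈ {i = inject₁ i} {suc i} {inject₁ i′} {suc i′}
           (cong suc (sym (Fin.toℕ-inject₁ i))) (cong suc (sym (Fin.toℕ-inject₁ i′))) e f)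
    = cong (_, i) (g-injˡ (suc i) f)

-- Cauchy reals

-- `x ≈ y` unfolds to `Null` of the termwise difference, so facts about `≈` reduce to ring
-- identities in ℚ and closure of null sequences under sums and negation.
Null : (ℕ → ℚ) → Set
Null p = ∀ ε → 0ℚ ℚ.< ε → ∃ λ N → ∀ n → N ℕ.≤ n → ∣ p n ∣ ℚ.< ε

null-cong : ∀ {p q} → (∀ n → p n ≡ q n) → Null p → Null q
null-cong e h ε 0<ε = let N , f = h ε 0<ε in
  N , λ n n≥ → subst (λ r → ∣ r ∣ ℚ.< ε) (e n) (f n n≥)

null-+ : ∀ {p q} → Null p → Null q → Null (λ n → p n ℚ.+ q n)
null-+ {p} {q} g h ε 0<ε =
  let M , f₁ = g (½ ℚ.* ε) (half-pos 0<ε)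
      N , f₂ = h (½ ℚ.* ε) (half-pos 0<ε)
  in M ℕ.⊔ N , λ n n≥ → subst (∣ p n ℚ.+ q n ∣ ℚ.<_) (half+half ε)
    (ℚ.≤-<-trans (ℚ.∣p+q∣≤∣p∣+∣q∣ (p n) (q n))
      (ℚ.+-mono-< (f₁ n (ℕ.m⊔n≤o⇒m≤o M N n≥)) (f₂ n (ℕ.m⊔n≤o⇒n≤o M N n≥))))

null-neg : ∀ {p} → Null p → Null (λ n → ℚ.- p n)
null-neg {p} h ε 0<ε = let N , f = h ε 0<ε in
  N , λ n n≥ → subst (ℚ._< ε) (sym (ℚ.∣-p∣≡∣p∣ (p n))) (f n n≥)

≈-sym : ∀ {x y} → x ≈ y → y ≈ x
≈-sym {x} {y} h = null-cong (λ n → flip-- (seq x n) (seq y n)) (null-neg h)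

≈-trans : ∀ {x y z} → x ≈ y → y ≈ z → x ≈ z
≈-trans {x} {y} {z} g h = null-cong
  (λ n → solve 3 (λ x y z → (x :- y) :+ (y :- z) := x :- z) refl (seq x n) (seq y n) (seq z n))
  (null-+ g h)
  where open ℚ-Solver

≈-refl : ∀ {x} → x ≈ x
≈-refl {x} ε 0<ε = 0 , λ n _ → subst (λ d → ∣ d ∣ ℚ.< ε) (sym (ℚ.+-inverseʳ (seq x n))) 0<ε

+-cancelˡ-≈ : ∀ {a b b′ c} → a + b ≈ c → a + b′ ≈ c → b ≈ b′
+-cancelˡ-≈ {a} {b} {b′} {c} g h = null-cong
  (λ n → solve 4 (λ a b b′ c → (a :+ b :- c) :- (a :+ b′ :- c) := b :- b′) refl
           (seq a n) (seq b n) (seq b′ n) (seq c n))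
  (null-+ g (null-neg h))
  where open ℚ-Solver

-- Both differences equal `c′ - c`, as the shifts `b` and `b′` cancel. This is how two elements of
-- the sumset determine a difference in A.
differences-≈ : ∀ {a a′ d d′ b b′ c c′} → a + b ≈ c → a′ + b ≈ c′ → d + b′ ≈ c → d′ + b′ ≈ c′ →
                a′ - a ≈ d′ - d
differences-≈ {a} {a′} {d} {d′} {b} {b′} {c} {c′} h₁ h₂ h₃ h₄ = null-cong
  (λ n → solve 8 (λ a a′ d d′ b b′ c c′ →
           ((a′ :+ b :- c′) :- (d′ :+ b′ :- c′)) :+ ((d :+ b′ :- c) :- (a :+ b :- c)) :=
           (a′ :- a) :- (d′ :- d)) refl
           (seq a n) (seq a′ n) (seq d n) (seq d′ n) (seq b n) (seq b′ n) (seq c n) (seq c′ n))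
  (null-+ (null-+ h₂ (null-neg h₄)) (null-+ h₃ (null-neg h₁)))
  where open ℚ-Solver

-- Moving each end of a gap ε inwards by less than ε/4 leaves more than ε/2. It serves both a change
-- of representative and a change of index within a Cauchy sequence.
half-gap : ∀ {p p′ r r′} ε → p ℚ.- p′ ℚ.< ½ ℚ.* (½ ℚ.* ε) → r ℚ.- r′ ℚ.< ½ ℚ.* (½ ℚ.* ε) →
           p′ ℚ.+ ε ℚ.≤ r → p ℚ.+ ½ ℚ.* ε ℚ.< r′
half-gap {p} {p′} {r} {r′} ε g h k = begin-strict
  p ℚ.+ ½ ℚ.* ε
    ≡⟨ solve 3 (λ p p′ e → p :+ con ½ :* e := (p :- p′) :+ (p′ :+ con ½ :* e)) refl p p′ ε ⟩
  (p ℚ.- p′) ℚ.+ (p′ ℚ.+ ½ ℚ.* ε)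
    <⟨ ℚ.+-monoˡ-< (p′ ℚ.+ ½ ℚ.* ε) g ⟩
  q ℚ.+ (p′ ℚ.+ ½ ℚ.* ε)
    ≡⟨ solve 2 (λ p e → con ½ :* (con ½ :* e) :+ (p :+ con ½ :* e) := (p :+ e) :- con ½ :* (con ½ :* e)) refl p′ ε ⟩
  (p′ ℚ.+ ε) ℚ.- q
    ≤⟨ ℚ.+-monoˡ-≤ (ℚ.- q) k ⟩
  r ℚ.- q
    ≡⟨ solve 3 (λ r r′ q → r :- q := (r :- r′) :+ (r′ :- q)) refl r r′ q ⟩
  (r ℚ.- r′) ℚ.+ (r′ ℚ.- q)
    <⟨ ℚ.+-monoˡ-< (r′ ℚ.- q) h ⟩
  q ℚ.+ (r′ ℚ.- q)
    ≡⟨ solve 2 (λ r q → q :+ (r :- q) := r) refl r′ q ⟩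
  r′ ∎
  where
  open ℚ.≤-Reasoning
  open ℚ-Solver
  q = ½ ℚ.* (½ ℚ.* ε)

∣p∣<r⇒p<r : ∀ {p r} → ∣ p ∣ ℚ.< r → p ℚ.< r
∣p∣<r⇒p<r {p} h = ℚ.≤-<-trans (p≤∣p∣ p) h
  where
  p≤∣p∣ : ∀ p → p ℚ.≤ ∣ p ∣
  p≤∣p∣ p with ℚ.≤-total 0ℚ p
  ... | inj₁ 0≤p = ℚ.≤-reflexive (sym (ℚ.0≤p⇒∣p∣≡p 0≤p))
  ... | inj₂ p≤0 = ℚ.≤-trans p≤0 (ℚ.0≤∣p∣ p)

<-resp-≈ : ∀ {x x′ y y′} → x ≈ x′ → y ≈ y′ → x < y → x′ < y′
<-resp-≈ {x} {x′} {y} {y′} x≈x′ y≈y′ (ε , 0<ε , N , h) =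
  let q      = ½ ℚ.* (½ ℚ.* ε)
      0<q    = half-pos (half-pos 0<ε)
      M , f  = ≈-sym {x} {x′} x≈x′ q 0<q
      K , f′ = y≈y′ q 0<q
  in ½ ℚ.* ε , half-pos 0<ε , N ℕ.⊔ (M ℕ.⊔ K) , λ n n≥ →
     let n≥′ = ℕ.m⊔n≤o⇒n≤o N (M ℕ.⊔ K) n≥
     in half-gap {seq x′ n} {seq x n} {seq y n} ε
          (∣p∣<r⇒p<r (f n (ℕ.m⊔n≤o⇒m≤o M K n≥′)))
          (∣p∣<r⇒p<r (f′ n (ℕ.m⊔n≤o⇒n≤o M K n≥′)))
          (ℚ.<⇒≤ (h n (ℕ.m⊔n≤o⇒m≤o N (M ℕ.⊔ K) n≥)))

<-irrefl : ∀ {x} → ¬ (x < x)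
<-irrefl {x} (ε , 0<ε , N , h) = ℚ.<-irrefl refl (begin-strict
  seq x N          ≡⟨ sym (ℚ.+-identityʳ (seq x N)) ⟩
  seq x N ℚ.+ 0ℚ   <⟨ ℚ.+-monoʳ-< (seq x N) 0<ε ⟩
  seq x N ℚ.+ ε    <⟨ h N ℕ.≤-refl ⟩
  seq x N          ∎)
  where open ℚ.≤-Reasoning

<-trans : ∀ {x y z} → x < y → y < z → x < z
<-trans {x} {y} {z} (ε , 0<ε , M , g) (ε′ , 0<ε′ , N , h) = ε , 0<ε , M ℕ.⊔ N , λ n n≥ → begin-strict
  seq x n ℚ.+ ε    <⟨ g n (ℕ.m⊔n≤o⇒m≤o M N n≥) ⟩
  seq y n          ≡⟨ sym (ℚ.+-identityʳ (seq y n)) ⟩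
  seq y n ℚ.+ 0ℚ   <⟨ ℚ.+-monoʳ-< (seq y n) 0<ε′ ⟩
  seq y n ℚ.+ ε′   <⟨ h n (ℕ.m⊔n≤o⇒n≤o M N n≥) ⟩
  seq z n          ∎
  where open ℚ.≤-Reasoning

+-monoˡ-< : ∀ {x y} z → x < y → x + z < y + z
+-monoˡ-< {x} {y} z (ε , 0<ε , N , h) = ε , 0<ε , N , λ n n≥ →
  subst (ℚ._< seq y n ℚ.+ seq z n)
    (solve 3 (λ x e z → (x :+ e) :+ z := (x :+ z) :+ e) refl (seq x n) ε (seq z n))
    (ℚ.+-monoˡ-< (seq z n) (h n n≥))
  where open ℚ-Solver

-- If `y` exceeded `x` by ε at one index past both Cauchy moduli, it would exceed `x` by more than
-- ε/2 at all of them, giving `x < y`. Comparison in ℚ is decidable, so the refutation yields the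
-- inequality itself.
≮⇒eventually-close : ∀ {x y} → ¬ (x < y) → ∀ ε → 0ℚ ℚ.< ε →
  ∃ λ N → ∀ n → N ℕ.≤ n → seq y n ℚ.- seq x n ℚ.< ε
≮⇒eventually-close {x} {y} x≮y ε 0<ε =
  let q      = ½ ℚ.* (½ ℚ.* ε)
      0<q    = half-pos (half-pos 0<ε)
      M , f  = cauchy x q 0<q
      K , f′ = cauchy y q 0<q
      N      = M ℕ.⊔ K
  in N , λ n n≥ → decidable-stable (seq y n ℚ.- seq x n ℚ.<? ε) λ ≮ε →
     x≮y (½ ℚ.* ε , half-pos 0<ε , N , λ m m≥ →
       half-gap {seq x m} {seq x n} {seq y n} ε
         (∣p∣<r⇒p<r (f m n (ℕ.m⊔n≤o⇒m≤o M K m≥) (ℕ.m⊔n≤o⇒m≤o M K n≥)))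
         (∣p∣<r⇒p<r (f′ n m (ℕ.m⊔n≤o⇒n≤o M K n≥) (ℕ.m⊔n≤o⇒n≤o M K m≥)))
         (subst (seq x n ℚ.+ ε ℚ.≤_)
           (solve 2 (λ x y → x :+ (y :- x) := y) refl (seq x n) (seq y n))
           (ℚ.+-monoʳ-≤ (seq x n) (ℚ.≮⇒≥ ≮ε))))
  where open ℚ-Solver

≮∧≯⇒≈ : ∀ {x y} → ¬ (x < y) → ¬ (y < x) → x ≈ y
≮∧≯⇒≈ {x} {y} x≮y y≮x ε 0<ε =
  let M , f = ≮⇒eventually-close {y} {x} y≮x ε 0<ε
      N , g = ≮⇒eventually-close {x} {y} x≮y ε 0<ε
  in M ℕ.⊔ N , λ n n≥ → ∣-∣-< {seq x n} {seq y n}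
       (f n (ℕ.m⊔n≤o⇒m≤o M N n≥)) (g n (ℕ.m⊔n≤o⇒n≤o M N n≥))

-- Ranks in a finite family of reals.

module Rank {n} (e : Fin n → ℝ) (_<?_ : ∀ i j → Dec (e i < e j)) where

  rank : Fin n → ℕ
  rank i = length (filter (_<? i) (allFin n))

  rank<n : ∀ i → rank i ℕ.< n
  rank<n i = subst (rank i ℕ.<_) (length-tabulate {n = n} (λ j → j))
    (filter-notAll (_<? i) (allFin n) (Any.map (λ { refl → <-irrefl {e i} }) (∈-allFin i)))

  -- By transitivity whatever counts for `i` counts for `j`, and `i` itself counts only for `j`.
  rank-mono : ∀ {i j} → e i < e j → rank i ℕ.< rank j
  rank-mono {i} {j} i<j = length-filter-mono-< (_<? i) (_<? j)
    (λ {k} k<i → <-trans {e k} {e i} {e j} k<i i<j) (∈-allFin i) (<-irrefl {e i}) i<j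

  -- Equal ranks exclude both strict inequalities, which forces `≈` without deciding equality.
  rank-injective : Injective _≡_ _≈_ e → Injective _≡_ _≡_ rank
  rank-injective inj {i} {j} eq = inj (≮∧≯⇒≈ {e i} {e j}
    (λ i<j → ℕ.<⇒≢ (rank-mono i<j) eq) (λ j<i → ℕ.<⇒≢ (rank-mono j<i) (sym eq)))

-- Excluded middle is irrefutable for each pair, and double negation commutes with finite
-- conjunctions, here over both indices.
¬¬-decidable : ∀ {n} (R : Fin n → Fin n → Set) → ¬ ¬ (∀ i j → Dec (R i j))
¬¬-decidable R = Fin.sequence ¬¬-applicative λ i → Fin.sequence ¬¬-applicative λ j → ¬¬-excluded-middle
  where ¬¬-applicative = RawMonad.rawApplicative ¬¬-Monad

-- The sumset bound in square-free-root form, k² l ≤ 25 n².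

lists⇒size-≤ : ∀ {A k m} {a : Fin m → ℝ} → HasSize A k → a Lists A → k ℕ.≤ m
lists⇒size-≤ {A} {k} {m} {a} (e , e-inj , e-lists) a-lists = Fin.injective⇒≤ {f = λ i → proj₁ (index i)}
  λ {i} {j} eq → e-inj (≈-trans {e i} {a (proj₁ (index i))} {e j} (proj₂ (index i))
    (≈-sym {e j} {a (proj₁ (index i))} (subst (λ p → e j ≈ a p) (sym eq) (proj₂ (index j)))))
  where
  index : ∀ i → ∃ λ j → e i ≈ a j
  index i = Equivalence.to (a-lists (e i)) (Equivalence.from (e-lists (e i)) (i , ≈-refl {e i}))

sumset-bound : ∀ {A B k l n} → HasSize A k → HasSize B l → DistinctConsecutiveDifferences A →
  HasSize (A ⊕ B) n → k ℕ.* k ℕ.* l ℕ.≤ 25 ℕ.* (n ℕ.* n)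
sumset-bound {A} {B} {k} {l} {n} A-size (b , b-inj , b-lists) (k′ , a , a-inc , a-lists , a-dcd)
  (e , e-inj , e-lists) =
  ℕ.≤-trans (ℕ.*-monoˡ-≤ l (ℕ.*-mono-≤ k≤k′ k≤k′))
    (decidable-stable (_ ℕ.≤? _) (¬¬-map bound (¬¬-decidable (λ p q → e p < e q))))
  where
  -- The increasing listing of A has its own length `k′`; the bound is proved for `k′` and carried
  -- down to `k`.
  k≤k′ : k ℕ.≤ k′
  k≤k′ = lists⇒size-≤ {A} {a = a} A-size a-lists

  index : ∀ j i → ∃ λ p → a i + b j ≈ e p
  index j i = Equivalence.to (e-lists (a i + b j))
    ( a i , b j
    , Equivalence.from (a-lists (a i)) (i , ≈-refl {a i})
    , Equivalence.from (b-lists (b j)) (j , ≈-refl {b j})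
    , ≈-refl {a i + b j})

  C : Fin l → Fin k′ → ℝ
  C j i = e (proj₁ (index j i))

  index-≈ : ∀ {j j′ i i′} → proj₁ (index j i) ≡ proj₁ (index j′ i′) → a i′ + b j′ ≈ C j i
  index-≈ {j′ = j′} {i′ = i′} eq = subst (λ p → a i′ + b j′ ≈ e p) (sym eq) (proj₂ (index j′ i′))

  -- Rows are strictly increasing because translation preserves `<`, columns are injective by
  -- cancelling `a i`, and distinct differences let consecutive ranks determine `i`.
  bound : (∀ p q → Dec (e p < e q)) → k′ ℕ.* k′ ℕ.* l ℕ.≤ 25 ℕ.* (n ℕ.* n)
  bound dec = injective-rows-bound k′ l n (λ j i → rank (proj₁ (index j i)))
    (λ j i → rank<n (proj₁ (index j i)))
    (λ j {i} {i′} i<i′ → rank-mono (<-resp-≈ {a i + b j} {C j i} {a i′ + b j} {C j i′}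
      (proj₂ (index j i)) (proj₂ (index j i′)) (+-monoˡ-< {a i} {a i′} (b j) (a-inc i<i′))))
    (λ {j} {j′} i eq → b-inj (+-cancelˡ-≈ {a i} {b j} {b j′} {C j i}
      (proj₂ (index j i)) (index-≈ (rank-injective e-inj eq))))
    (λ {j} {j′} {i} {i′} {h} {h′} i′≡ h′≡ eq eq′ → a-dcd i′≡ h′≡
      (differences-≈ {a i} {a i′} {a h} {a h′} {b j} {b j′} {C j i} {C j i′}
        (proj₂ (index j i)) (proj₂ (index j i′))
        (index-≈ (rank-injective e-inj eq)) (index-≈ (rank-injective e-inj eq′))))
    where open Rank e dec

-- From the integer inequality to real square roots.

ι-nonNeg : ∀ n → 0ℚ ℚ.≤ ι n
ι-nonNeg n = ι-mono-≤ {0} {n} ℕ.z≤n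

-- As `≤` is the negation of `<`, it suffices to refute the strict inequality at one index: there n
-- < q s with s² ≤ l, whence n² < q² l.
scaled-√-≤ : ∀ q l n → 0ℚ ℚ.≤ q → q ℚ.* q ℚ.* ι l ℚ.≤ ι n ℚ.* ι n → fromℚ q * √ l ≤ fromℕ n
scaled-√-≤ q l n 0≤q q²l≤n² (ε , 0<ε , N , h) = ℚ.<-irrefl refl (begin-strict
  ι n ℚ.* ι n                   ≤⟨ ℚ.*-monoˡ-≤-nonNeg (ι n) {{ℚ.nonNegative (ι-nonNeg n)}} (ℚ.<⇒≤ n<qs) ⟩
  ι n ℚ.* (q ℚ.* s)             <⟨ ℚ.*-monoˡ-<-pos (q ℚ.* s) {{ℚ.positive (ℚ.≤-<-trans (ι-nonNeg n) n<qs)}} n<qs ⟩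
  q ℚ.* s ℚ.* (q ℚ.* s)         ≡⟨ solve 2 (λ q s → q :* s :* (q :* s) := q :* q :* (s :* s)) refl q s ⟩
  q ℚ.* q ℚ.* (s ℚ.* s)         ≤⟨ ℚ.*-monoˡ-≤-nonNeg (q ℚ.* q) {{ℚ.nonNegative 0≤q²}} (√-seq-lower l N) ⟩
  q ℚ.* q ℚ.* ι l               ≤⟨ q²l≤n² ⟩
  ι n ℚ.* ι n                   ∎)
  where
  open ℚ.≤-Reasoning
  open ℚ-Solver
  s = √-seq l N

  n<qs : ι n ℚ.< q ℚ.* s
  n<qs = ℚ.<-trans (subst (ℚ._< ι n ℚ.+ ε) (ℚ.+-identityʳ (ι n)) (ℚ.+-monoʳ-< (ι n) 0<ε)) (h N ℕ.≤-refl)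

  0≤q² : 0ℚ ℚ.≤ q ℚ.* q
  0≤q² = *-mono-≤-nonNeg ℚ.≤-refl 0≤q 0≤q 0≤q

⅕ : ℚ
⅕ = + 1 ℚ./ 5

⅕-scaling : ∀ j n → j ℕ.≤ 25 ℕ.* (n ℕ.* n) → ⅕ ℚ.* ⅕ ℚ.* ι j ℚ.≤ ι n ℚ.* ι n
⅕-scaling j n h = begin
  ⅕ ℚ.* ⅕ ℚ.* ι j                        ≤⟨ ℚ.*-monoˡ-≤-nonNeg (⅕ ℚ.* ⅕) (ι-mono-≤ h) ⟩
  ⅕ ℚ.* ⅕ ℚ.* ι (25 ℕ.* (n ℕ.* n))       ≡⟨ cong (⅕ ℚ.* ⅕ ℚ.*_) (ι-homo-* 25 (n ℕ.* n)) ⟩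
  ⅕ ℚ.* ⅕ ℚ.* (ι 25 ℚ.* ι (n ℕ.* n))     ≡⟨ sym (ℚ.*-assoc (⅕ ℚ.* ⅕) (ι 25) (ι (n ℕ.* n))) ⟩
  -- The closed product of ⅕, ⅕ and 25 evaluates to 1.
  1ℚ ℚ.* ι (n ℕ.* n)                     ≡⟨ ℚ.*-identityˡ (ι (n ℕ.* n)) ⟩
  ι (n ℕ.* n)                            ≡⟨ ι-homo-* n n ⟩
  ι n ℚ.* ι n                            ∎
  where open ℚ.≤-Reasoning

theorem1 : ∃ λ (c : ℝ) → 0ℝ < c ×
    ((A B : Pred ℝ 0ℓ) (k l n : ℕ) →
    Satisfiable A → Satisfiable B →
    HasSize A k → HasSize B l →
    DistinctConsecutiveDifferences A →
    HasSize (A ⊕ B) n →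
    (c * fromℕ k * √ l ≤ fromℕ n) ×
    (k ≡ l → c * √ (k ^ 3) ≤ fromℕ n))
-- The constant is c = 1/5, and half of it is the uniform gap witnessing its positivity.
theorem1 = fromℚ ⅕ , (½ ℚ.* ⅕ , half-pos (ℚ.positive⁻¹ ⅕) , 0 , λ _ _ → from-yes (0ℚ ℚ.+ ½ ℚ.* ⅕ ℚ.<? ⅕)) ,
  λ A B k l n _ _ A-size B-size A-dcd C-size →
    let k²l≤25n² = sumset-bound {A} {B} A-size B-size A-dcd C-size
    -- The factor k joins the constant, as q = k/5; for k = l below, q = 1/5 and k² l becomes k³
    -- under the root.
    in scaled-√-≤ (⅕ ℚ.* ι k) l n (*-mono-≤-nonNeg ℚ.≤-refl (ι-nonNeg k) 0≤⅕ (ι-nonNeg k))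
         (subst (ℚ._≤ ι n ℚ.* ι n) (regroup k l) (⅕-scaling (k ℕ.* k ℕ.* l) n k²l≤25n²))
     , λ { refl → scaled-√-≤ ⅕ (k ^ 3) n 0≤⅕ (⅕-scaling (k ^ 3) n (subst (ℕ._≤ 25 ℕ.* (n ℕ.* n)) (cube k) k²l≤25n²)) }
  where
  0≤⅕ : 0ℚ ℚ.≤ ⅕
  0≤⅕ = ℚ.nonNegative⁻¹ ⅕
  regroup : ∀ k l → ⅕ ℚ.* ⅕ ℚ.* ι (k ℕ.* k ℕ.* l) ≡ ⅕ ℚ.* ι k ℚ.* (⅕ ℚ.* ι k) ℚ.* ι l
  regroup k l = trans
    (cong (⅕ ℚ.* ⅕ ℚ.*_) (trans (ι-homo-* (k ℕ.* k) l) (cong (ℚ._* ι l) (ι-homo-* k k))))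
    (solve 3 (λ c k l → c :* c :* (k :* k :* l) := c :* k :* (c :* k) :* l) refl ⅕ (ι k) (ι l))
    where open ℚ-Solver
  cube : ∀ k → k ℕ.* k ℕ.* k ≡ k ^ 3
  cube = solve 1 (λ k → k :* k :* k := k :^ 3) refl
    where open ℕ-Solver
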